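{- Let $A,B\in\mathcal{PC}_4^0$. If $\mathcal{E}(A)=\mathcal{E}(B)$, then $\min_{\rho\in\Gamma(A)}\rho(A)=\min_{\rho\in\Gamma(B)}\rho(B)$.
   Context: Let $N=\{1,2,3,4\}$. A matrix $A=[a_{ij}]\in M_4$ is reciprocal if its entries are positive and $a_{ji}=1/a_{ij}$; $\mathcal{PC}_4$ is the set of $4\times4$ reciprocal matrices; $A$ is consistent if $a_{ij}a_{jk}=a_{ik}$ for all $i,j,k$; $\mathcal{PC}_4^0$ is the set of non-consistent matrices in $\mathcal{PC}_4$. $\mathbb{R}^4_+$ is the set of positive vectors; for $w\in\mathbb{R}^4_+$, $ww^{(-T)}=[w_i/w_j]$. A vector $w\in\mathbb{R}^4_+$ is efficient for $A$ if, for every $v\in\mathbb{R}^4_+$, the entry-wise inequality $|A-vv^{(-T)}|\le|A-ww^{(-T)}|$ implies that $v$ is a positive multiple of $w$; $\mathcal{E}(A)$ is the set of efficient vectors. A Hamiltonian cycle (H-cycle) in $N$ is a cyclic sequence $\tau=\tau_1\tau_2\tau_3\tau_4\tau_1$ with $\tau_1\tau_2\tau_3\tau_4$ a permutation of $N$. $\tau(A)=a_{\tau_1\tau_2}a_{\tau_2\tau_3}a_{\tau_3\tau_4}a_{\tau_4\tau_1}$, and $\Gamma(A)$ is the set of H-cycles $\tau$ with $\tau(A)<1$ (nonempty when $A$ is not consistent). -}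

module Defs where

open import Data.Fin using (Fin; zero; suc)
open import Data.Product using (Σ; ∃; _×_; _,_)
open import Data.Sum using (_⊎_)
open import Relation.Binary.PropositionalEquality using (_≡_; _≢_)
open import Relation.Binary using (Tri; tri<; tri≈; tri>)
open import Relation.Binary.Structures using (IsStrictTotalOrder)
open import Algebra.Structures using (IsCommutativeRing)
open import Function.Definitions using (Injective)
open import Relation.Nullary using (¬_)

-- The real numbers, axiomatised as a Dedekind-complete ordered field
-- (any model is isomorphic to ℝ).  Equality is propositional equality.
record RealField : Set₁ where
  infixl 6 _+_ _-_
  infixl 7 _*_
  infix 4 _<_ _≤_
  field
    R     : Set
    0r 1r : R
    _+_ _*_ : R → R → R
    -_    : R → R
    inv   : R → R          -- multiplicative inverse (junk value at 0)
    _<_   : R → R → Set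
    isCommutativeRing : IsCommutativeRing _≡_ _+_ _*_ -_ 0r 1r
    isStrictTotalOrder : IsStrictTotalOrder _≡_ _<_
    inv-correct : ∀ x → x ≢ 0r → x * inv x ≡ 1r
    0<1   : 0r < 1r
    +-mono-< : ∀ x y z → x < y → x + z < y + z
    *-pos : ∀ x y → 0r < x → 0r < y → 0r < x * y

  _≤_ : R → R → Set
  x ≤ y = x < y ⊎ x ≡ y

  _-_ : R → R → R
  x - y = x + (- y)

  field
    complete : ∀ (P : R → Set) → (∃ λ x → P x) → (∃ λ b → ∀ x → P x → x ≤ b) →
               ∃ λ s → (∀ x → P x → x ≤ s) × (∀ b → (∀ x → P x → x ≤ b) → s ≤ b)

  open IsStrictTotalOrder isStrictTotalOrder using (compare)

  ∣_∣ : R → R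
  ∣ x ∣ with compare x 0r
  ... | tri< _ _ _ = - x
  ... | tri≈ _ _ _ = x
  ... | tri> _ _ _ = x

module Real (ℝ : RealField) where
  open RealField ℝ

  N : Set
  N = Fin 4

  Matrix : Set
  Matrix = N → N → R

  Vector : Set
  Vector = N → R

  Positive : Vector → Set
  Positive v = ∀ i → 0r < v i

  Reciprocal : Matrix → Set
  Reciprocal A = (∀ i j → 0r < A i j) × (∀ i j → A j i ≡ inv (A i j))

  Consistent : Matrix → Set
  Consistent A = ∀ i j k → A i j * A j k ≡ A i k

  PC⁰ : Matrix → Set
  PC⁰ A = Reciprocal A × ¬ Consistent A

  ratio : Vector → Matrix
  ratio w i j = w i * inv (w j)

  Efficient : Matrix → Vector → Set
  Efficient A w =
    Positive w ×
    (∀ v → Positive v →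
      (∀ i j → ∣ A i j - ratio v i j ∣ ≤ ∣ A i j - ratio w i j ∣) →
      ∃ λ c → 0r < c × (∀ i → v i ≡ c * w i))

  SameEfficient : Matrix → Matrix → Set
  SameEfficient A B = ∀ w → (Efficient A w → Efficient B w) × (Efficient B w → Efficient A w)

  -- An H-cycle τ₁τ₂τ₃τ₄τ₁ is given by a permutation τ of N (injective map).
  HCycle : (N → N) → Set
  HCycle τ = Injective _≡_ _≡_ τ

  i0 i1 i2 i3 : N
  i0 = zero
  i1 = suc zero
  i2 = suc (suc zero)
  i3 = suc (suc (suc zero))

  cycleVal : Matrix → (N → N) → R
  cycleVal A τ = A (τ i0) (τ i1) * A (τ i1) (τ i2) * A (τ i2) (τ i3) * A (τ i3) (τ i0)

  InΓ : Matrix → (N → N) → Set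
  InΓ A τ = HCycle τ × cycleVal A τ < 1r

  IsMinΓ : Matrix → R → Set
  IsMinΓ A m = (∃ λ τ → InΓ A τ × cycleVal A τ ≡ m) × (∀ τ → InΓ A τ → m ≤ cycleVal A τ)

{-# OPTIONS --safe #-}
module Submission where

-- For an H-cycle σ with σ(B) ≤ 1 the vectors w with b_{σₖσₖ₊₁} w_{σₖ₊₁} ≤ w_{σₖ} for all k form, in
-- logarithmic coordinates, a tetrahedron on which each log wᵢ − log wⱼ (i ≠ j) ranges over an interval
-- of length −log σ(B).  The efficient vectors of B are the union of these tetrahedra, by Camion's
-- theorem applied to the digraph with an edge i → j when bᵢⱼ wⱼ ≤ wᵢ.  Up to reversal there are only
-- three H-cycles, so if 𝓔(A) ⊆ 𝓔(B) and τ(A) < 1, two of the four vertices of the tetrahedron of τ for A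
-- lie in one tetrahedron for B.  Some log wᵢ − log wⱼ changes by −log τ(A) between these two vertices,
-- hence σ(B) ≤ τ(A) for some σ; exchanging A and B makes the minima equal.

open import Defs
open import Algebra.Bundles using (CommutativeRing)
open import Data.Bool using (Bool; T; not; true; false; if_then_else_)
open import Data.Bool.Properties using (T?)
open import Data.Fin using (Fin; zero; suc; punchOut) renaming (_<_ to _<ᶠ_; _≤_ to _≤ᶠ_; _≤?_ to _≤ᶠ?_)
open import Data.Fin.Patterns using (0F; 1F; 2F; 3F)
open import Data.Fin.Properties using (_≟_; all?; any?; injective⇒≤; punchOut-injective; pigeonhole)
open import Data.Fin.Subset using (Subset)
open import Data.Fin.Subset.Properties using (anySubset?)
open import Data.Nat.Base using (module ℕ; z≤n) renaming (_<_ to _<ℕ_)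
open import Data.Nat.Properties using (1+n≰n; n≤1+n; <⇒≱) renaming (≤-refl to ≤ℕ-refl; ≤-trans to ≤ℕ-trans)
open import Data.Product using (∃; _×_; _,_; proj₁; proj₂)
open import Data.Sum using (_⊎_; inj₁; inj₂; reduce; fromInj₁) renaming (map to ⊎-map)
open import Data.Unit using (tt)
open import Data.Vec using (_∷_; []; lookup; tabulate)
open import Data.Vec.Properties using (lookup∘tabulate)
open import Function using (_∘_; flip; id)
open import Function.Definitions using (Injective)
open import Relation.Binary.Bundles using (StrictTotalOrder; DecTotalOrder)
open import Relation.Binary.Definitions using (tri<; tri≈; tri>)
open import Relation.Binary.PropositionalEquality
  using (_≡_; _≢_; refl; sym; trans; cong; cong₂; subst; subst₂)
open import Relation.Nullary using (Dec; yes; no; ¬_; contradiction)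
open import Relation.Nullary.Decidable
  using (_×-dec_; _⊎-dec_; _→-dec_; ¬?; isYes; toWitness; fromWitness; toWitnessFalse; decidable-stable)
import Algebra.Properties.AbelianGroup
import Algebra.Solver.CommutativeMonoid
import Relation.Binary.Properties.StrictTotalOrder
import Relation.Binary.Reasoning.StrictPartialOrder

-- Hamiltonian cycles on four vertices.

Closed : ∀ {V : Set} → (V → V → Set) → (Fin 4 → V) → Set
Closed E ρ = E (ρ 0F) (ρ 1F) × E (ρ 1F) (ρ 2F) × E (ρ 2F) (ρ 3F) × E (ρ 3F) (ρ 0F)

closed-map : ∀ {V : Set} {E F : V → V → Set} ρ → (∀ i j → E i j → F i j) → Closed E ρ → Closed F ρ
closed-map ρ f (a , b , c , d) = f _ _ a , f _ _ b , f _ _ c , f _ _ d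

-- The three Hamiltonian cycles of K₄ up to reversal.
cycle : Fin 3 → Fin 4 → Fin 4
cycle 0F = lookup (0F ∷ 1F ∷ 2F ∷ 3F ∷ [])
cycle 1F = lookup (0F ∷ 2F ∷ 3F ∷ 1F ∷ [])
cycle 2F = lookup (0F ∷ 3F ∷ 1F ∷ 2F ∷ [])

cycle-start : ∀ c → cycle c 0F ≡ 0F
cycle-start 0F = refl
cycle-start 1F = refl
cycle-start 2F = refl

cycle-injective : ∀ c → Injective _≡_ _≡_ (cycle c)
cycle-injective c {i} {j} = toWitness
  {a? = all? λ c → all? λ i → all? λ j → (cycle c i ≟ cycle c j) →-dec (i ≟ j)} _ c i j

-- Position `0F` is kept fixed, so that a reversed cycle still starts where `cycle c` does.
backwards : Fin 4 → Fin 4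
backwards = lookup (0F ∷ 3F ∷ 2F ∷ 1F ∷ [])

backwards-injective : Injective _≡_ _≡_ backwards
backwards-injective {i} {j} = toWitness
  {a? = all? λ i → all? λ j → (backwards i ≟ backwards j) →-dec (i ≟ j)} _ i j

closed-backwards : ∀ {V : Set} {E : V → V → Set} {ρ} → Closed (flip E) ρ → Closed E (ρ ∘ backwards)
closed-backwards (a , b , c , d) = d , c , b , a

-- Injections of finite sets and the pigeonhole principle.

-- If `j` were missed, punching it out of the codomain would inject a finite set into a smaller one.
injective⇒surjective : ∀ {n} {f : Fin n → Fin n} → Injective _≡_ _≡_ f → ∀ j → ∃ λ i → f i ≡ j
injective⇒surjective {ℕ.zero} _ ()
injective⇒surjective {ℕ.suc _} {f} f-inj j with any? (λ i → f i ≟ j)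
... | yes ∃i = ∃i
... | no ∄i = contradiction
  (injective⇒≤ {f = λ i → punchOut (j≢f i)} λ {i} {i′} eq → f-inj (punchOut-injective (j≢f i) (j≢f i′) eq))
  1+n≰n
  where
  j≢f : ∀ i → j ≢ f i
  j≢f i j≡fi = ∄i (i , sym j≡fi)

-- Meant for four vertices of a tetrahedron as pigeons and the three cycles up to reversal as holes.
pigeonhole-share : ∀ {m n} → m <ℕ n → {P : Fin n → Fin m → Set} → (∀ i → ∃ (P i)) →
                   ∃ λ i → ∃ λ j → i <ᶠ j × ∃ λ c → P i c × P j c
pigeonhole-share m<n {P} f with i , j , i<j , same ← pigeonhole m<n (proj₁ ∘ f) =
  i , j , i<j , proj₁ (f j) , subst (P i) same (proj₂ (f i)) , proj₂ (f j)

-- Camion's theorem on four vertices.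

Total : (Fin 4 → Fin 4 → Set) → Set
Total E = ∀ i j → E i j ⊎ E j i

Hamiltonian : (Fin 4 → Fin 4 → Set) → Set
Hamiltonian E = ∃ λ c → Closed E (cycle c) ⊎ Closed (flip E) (cycle c)

-- A witness against strong connectivity, the hypothesis of Camion's theorem.
Cut : (Fin 4 → Fin 4 → Set) → Subset 4 → Set
Cut E S = (∃ λ i → T (lookup S i)) × (∃ λ j → T (not (lookup S j))) ×
          (∀ i j → T (lookup S i) → T (not (lookup S j)) → ¬ E i j)

module _ {E : Fin 4 → Fin 4 → Set} (E? : ∀ i j → Dec (E i j)) where

  closed? : ∀ ρ → Dec (Closed E ρ)
  closed? ρ = E? _ _ ×-dec E? _ _ ×-dec E? _ _ ×-dec E? _ _

  cut? : ∀ S → Dec (Cut E S)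
  cut? S = any? (λ i → T? _) ×-dec any? (λ j → T? _) ×-dec
    all? (λ i → all? λ j → T? _ →-dec T? _ →-dec ¬? (E? i j))

hamiltonianOrCut? : ∀ {E} → (∀ i j → Dec (E i j)) → Dec (Hamiltonian E ⊎ ∃ (Cut E))
hamiltonianOrCut? E? =
  any? (λ c → closed? E? (cycle c) ⊎-dec closed? (flip E?) (cycle c)) ⊎-dec anySubset? (cut? E?)

infix 10 _∋_ _∋?_

_∋_ : Subset 4 → Fin 4 → Set
r ∋ j = T (lookup r j)

-- A relation given by its four rows as bit vectors, so that all relations can be enumerated.
Table : Subset 4 → Subset 4 → Subset 4 → Subset 4 → Fin 4 → Fin 4 → Set
Table r₀ r₁ r₂ r₃ i j = lookup (r₀ ∷ r₁ ∷ r₂ ∷ r₃ ∷ []) i ∋ j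

table? : ∀ r₀ r₁ r₂ r₃ i j → Dec (Table r₀ r₁ r₂ r₃ i j)
table? _ _ _ _ _ _ = T? _

_∋?_ : ∀ (r : Subset 4) j → Dec (r ∋ j)
r ∋? j = T? _

-- Totality is imposed row by row so that the exhaustive search only visits the 3⁶ total relations.
camion-table : ¬ ∃ λ r₀ → r₀ ∋ 0F ×
               ∃ λ r₁ → r₁ ∋ 1F × (r₀ ∋ 1F ⊎ r₁ ∋ 0F) ×
               ∃ λ r₂ → r₂ ∋ 2F × (r₀ ∋ 2F ⊎ r₂ ∋ 0F) × (r₁ ∋ 2F ⊎ r₂ ∋ 1F) ×
               ∃ λ r₃ → r₃ ∋ 3F × (r₀ ∋ 3F ⊎ r₃ ∋ 0F) × (r₁ ∋ 3F ⊎ r₃ ∋ 1F) × (r₂ ∋ 3F ⊎ r₃ ∋ 2F) ×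
               ¬ (Hamiltonian (Table r₀ r₁ r₂ r₃) ⊎ ∃ (Cut (Table r₀ r₁ r₂ r₃)))
camion-table = toWitnessFalse
  {a? = anySubset? λ r₀ → (r₀ ∋? 0F) ×-dec
        anySubset? λ r₁ → (r₁ ∋? 1F) ×-dec (r₀ ∋? 1F ⊎-dec r₁ ∋? 0F) ×-dec
        anySubset? λ r₂ → (r₂ ∋? 2F) ×-dec (r₀ ∋? 2F ⊎-dec r₂ ∋? 0F) ×-dec (r₁ ∋? 2F ⊎-dec r₂ ∋? 1F) ×-dec
        anySubset? λ r₃ → (r₃ ∋? 3F) ×-dec (r₀ ∋? 3F ⊎-dec r₃ ∋? 0F) ×-dec (r₁ ∋? 3F ⊎-dec r₃ ∋? 1F) ×-dec
                          (r₂ ∋? 3F ⊎-dec r₃ ∋? 2F) ×-dec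
        ¬? (hamiltonianOrCut? (table? r₀ r₁ r₂ r₃))} _

-- Camion's theorem for four vertices.
camion : ∀ {E} → (∀ i j → Dec (E i j)) → Total E → Hamiltonian E ⊎ ∃ (Cut E)
camion {E} E? E-total = ⊎-map
  (λ (c , closed) → c , ⊎-map (closed-map (cycle c) from) (closed-map (cycle c) (flip from)) closed)
  (λ (S , i∈S , j∉S , cut) → S , i∈S , j∉S , λ i j i∈S j∉S → cut i j i∈S j∉S ∘ to i j)
  -- The search only refutes a counterexample; decidability of the alternative removes the double
  -- negation.
  (decidable-stable (hamiltonianOrCut? (table? _ _ _ _)) λ ¬h →
    camion-table (row 0F , loop 0F , row 1F , loop 1F , pair 0F 1F ,
                  row 2F , loop 2F , pair 0F 2F , pair 1F 2F ,
                  row 3F , loop 3F , pair 0F 3F , pair 1F 3F , pair 2F 3F , ¬h))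
  where
  row : Fin 4 → Subset 4
  row i = tabulate (λ j → isYes (E? i j))
  E′ : Fin 4 → Fin 4 → Set
  E′ = Table (row 0F) (row 1F) (row 2F) (row 3F)
  entry : ∀ i j → lookup (lookup (tabulate row) i) j ≡ isYes (E? i j)
  entry i j = trans (cong (λ r → lookup r j) (lookup∘tabulate row i)) (lookup∘tabulate (isYes ∘ E? i) j)
  to : ∀ i j → E i j → E′ i j
  to i j e = subst T (sym (entry i j)) (fromWitness e)
  pair : ∀ i j → E′ i j ⊎ E′ j i
  pair i j = ⊎-map (to i j) (to j i) (E-total i j)
  loop : ∀ i → E′ i i
  loop i = reduce (pair i i)
  from : ∀ i j → E′ i j → E i j
  from i j t = toWitness (subst T (entry i j) t)

-- Arithmetic of an ordered field.

module OrderedField (ℝ : RealField) where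
  open RealField ℝ

  commutativeRing : CommutativeRing _ _
  commutativeRing = record { isCommutativeRing = isCommutativeRing }

  open CommutativeRing commutativeRing public
    using (+-abelianGroup; +-comm; +-identityˡ; -‿inverseʳ; *-commutativeMonoid;
           *-comm; *-assoc; *-identityˡ; *-identityʳ; zeroʳ; distribʳ)
  open Algebra.Properties.AbelianGroup +-abelianGroup using (⁻¹-anti-homo‿-; \\-leftDividesˡ)

  strictTotalOrder : StrictTotalOrder _ _ _
  strictTotalOrder = record { isStrictTotalOrder = isStrictTotalOrder }

  open StrictTotalOrder strictTotalOrder public
    using (compare; strictPartialOrder) renaming (trans to <-trans; irrefl to <-irrefl)
  open DecTotalOrder (Relation.Binary.Properties.StrictTotalOrder.decTotalOrder strictTotalOrder) public
    using (_≤?_) renaming (total to ≤-total; antisym to ≤-antisym; refl to ≤-refl; trans to ≤-trans;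
                          reflexive to ≤-reflexive)
  module ≤-Reasoning = Relation.Binary.Reasoning.StrictPartialOrder strictPartialOrder
  open ≤-Reasoning

  private variable
    w x y z : R

  ≤⇒≯ : x ≤ y → ¬ y < x
  ≤⇒≯ {x} {y} x≤y y<x = <-irrefl refl (begin-strict x ≤⟨ x≤y ⟩ y <⟨ y<x ⟩ x ∎)

  ≰⇒> : ¬ x ≤ y → y < x
  ≰⇒> {x} {y} x≰y with compare x y
  ... | tri< x<y _ _ = contradiction (inj₁ x<y) x≰y
  ... | tri≈ _ x≡y _ = contradiction (inj₂ x≡y) x≰y
  ... | tri> _ _ y<x = y<x

  +-monoˡ-≤ : ∀ z → x ≤ y → x + z ≤ y + z
  +-monoˡ-≤ z (inj₁ x<y) = inj₁ (+-mono-< _ _ z x<y)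
  +-monoˡ-≤ z (inj₂ refl) = ≤-refl

  x+[y-x]≡y : ∀ x y → x + (y - x) ≡ y
  x+[y-x]≡y x y = trans (cong (x +_) (+-comm y (- x))) (\\-leftDividesˡ x y)

  -‿antitone-≤ : x ≤ y → - y ≤ - x
  -‿antitone-≤ {x} {y} x≤y = begin
    - y                  ≡⟨ x+[y-x]≡y x (- y) ⟨
    x + (- y - x)        ≤⟨ +-monoˡ-≤ _ x≤y ⟩
    y + (- y - x)        ≡⟨ cong (y +_) (+-comm (- y) (- x)) ⟩
    y + (- x - y)        ≡⟨ x+[y-x]≡y y (- x) ⟩
    - x                  ∎

  x<y⇒0<y-x : x < y → 0r < y - x
  x<y⇒0<y-x {x} {y} x<y = subst (_< y - x) (-‿inverseʳ x) (+-mono-< x y (- x) x<y)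

  0≤x⇒∣x∣≡x : 0r ≤ x → ∣ x ∣ ≡ x
  0≤x⇒∣x∣≡x {x} 0≤x with compare x 0r
  ... | tri< x<0 _ _ = contradiction x<0 (≤⇒≯ 0≤x)
  ... | tri≈ _ _ _ = refl
  ... | tri> _ _ _ = refl

  x<0⇒∣x∣≡-x : x < 0r → ∣ x ∣ ≡ - x
  x<0⇒∣x∣≡-x {x} x<0 with compare x 0r
  ... | tri< _ _ _ = refl
  ... | tri≈ x≮0 _ _ = contradiction x<0 x≮0
  ... | tri> x≮0 _ _ = contradiction x<0 x≮0

  x≤y⇒∣y-x∣≡y-x : x ≤ y → ∣ y - x ∣ ≡ y - x
  x≤y⇒∣y-x∣≡y-x {x} {y} (inj₁ x<y) = 0≤x⇒∣x∣≡x (inj₁ (x<y⇒0<y-x x<y))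
  x≤y⇒∣y-x∣≡y-x {x} (inj₂ refl) = 0≤x⇒∣x∣≡x (inj₂ (sym (-‿inverseʳ x)))

  x≤y⇒∣x-y∣≡y-x : x ≤ y → ∣ x - y ∣ ≡ y - x
  x≤y⇒∣x-y∣≡y-x {x} {y} (inj₁ x<y) = trans
    (x<0⇒∣x∣≡-x (subst (x - y <_) (-‿inverseʳ y) (+-mono-< x y (- y) x<y))) (⁻¹-anti-homo‿- x y)
  x≤y⇒∣x-y∣≡y-x {x} (inj₂ refl) = 0≤x⇒∣x∣≡x (inj₂ (sym (-‿inverseʳ x)))

  -- For an entry `z` approximated from below: raising the ratio towards it does no harm. The next
  -- lemma treats approximation from above.
  x≤y≤z⇒∣z-y∣≤∣z-x∣ : x ≤ y → y ≤ z → ∣ z - y ∣ ≤ ∣ z - x ∣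
  x≤y≤z⇒∣z-y∣≤∣z-x∣ {x} {y} {z} x≤y y≤z = begin
    ∣ z - y ∣  ≡⟨ x≤y⇒∣y-x∣≡y-x y≤z ⟩
    z - y      ≡⟨ +-comm z (- y) ⟩
    - y + z    ≤⟨ +-monoˡ-≤ z (-‿antitone-≤ x≤y) ⟩
    - x + z    ≡⟨ +-comm (- x) z ⟩
    z - x      ≡⟨ x≤y⇒∣y-x∣≡y-x (≤-trans x≤y y≤z) ⟨
    ∣ z - x ∣  ∎

  x≤y≤z⇒∣x-y∣≤∣x-z∣ : x ≤ y → y ≤ z → ∣ x - y ∣ ≤ ∣ x - z ∣
  x≤y≤z⇒∣x-y∣≤∣x-z∣ {x} {y} {z} x≤y y≤z = begin
    ∣ x - y ∣  ≡⟨ x≤y⇒∣x-y∣≡y-x x≤y ⟩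
    y - x      ≤⟨ +-monoˡ-≤ (- x) y≤z ⟩
    z - x      ≡⟨ x≤y⇒∣x-y∣≡y-x (≤-trans x≤y y≤z) ⟨
    ∣ x - z ∣  ∎

  -- What domination yields along an edge: where the ratio `z` of the given vector is at or above
  -- the entry `x`, the ratio `y` of a dominating vector cannot exceed it.
  ∣x-y∣≤∣x-z∣⇒y≤z : x ≤ z → ∣ x - y ∣ ≤ ∣ x - z ∣ → y ≤ z
  ∣x-y∣≤∣x-z∣⇒y≤z {x} {z} {y} x≤z le with compare y z
  ... | tri< y<z _ _ = inj₁ y<z
  ... | tri≈ _ y≡z _ = inj₂ y≡z
  ... | tri> _ _ z<y = contradiction (begin-strict
    ∣ x - z ∣  ≡⟨ x≤y⇒∣x-y∣≡y-x x≤z ⟩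
    z - x      <⟨ +-mono-< z y (- x) z<y ⟩
    y - x      ≡⟨ x≤y⇒∣x-y∣≡y-x (≤-trans x≤z (inj₁ z<y)) ⟨
    ∣ x - y ∣  ∎) (≤⇒≯ le)

  *-monoˡ-< : 0r < z → x < y → x * z < y * z
  *-monoˡ-< {z} {x} {y} 0<z x<y = begin-strict
    x * z                  ≡⟨ +-identityˡ _ ⟨
    0r + x * z             <⟨ +-mono-< _ _ _ (*-pos _ _ (x<y⇒0<y-x x<y) 0<z) ⟩
    (y - x) * z + x * z    ≡⟨ +-comm _ _ ⟩
    x * z + (y - x) * z    ≡⟨ distribʳ z x (y - x) ⟨
    (x + (y - x)) * z      ≡⟨ cong (_* z) (x+[y-x]≡y x y) ⟩
    y * z                  ∎

  *-monoˡ-≤ : 0r < z → x ≤ y → x * z ≤ y * z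
  *-monoˡ-≤ 0<z (inj₁ x<y) = inj₁ (*-monoˡ-< 0<z x<y)
  *-monoˡ-≤ 0<z (inj₂ refl) = ≤-refl

  *-monoʳ-≤ : 0r < z → x ≤ y → z * x ≤ z * y
  *-monoʳ-≤ {z} {x} {y} 0<z x≤y = subst₂ _≤_ (*-comm x z) (*-comm y z) (*-monoˡ-≤ 0<z x≤y)

  *-mono-≤ : 0r < x → 0r < y → w ≤ x → y ≤ z → w * y ≤ x * z
  *-mono-≤ 0<x 0<y w≤x y≤z = ≤-trans (*-monoˡ-≤ 0<y w≤x) (*-monoʳ-≤ 0<x y≤z)

  *-cancelʳ-≤ : 0r < z → x * z ≤ y * z → x ≤ y
  *-cancelʳ-≤ {z} {x} {y} 0<z xz≤yz with compare x y
  ... | tri< x<y _ _ = inj₁ x<y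
  ... | tri≈ _ x≡y _ = inj₂ x≡y
  ... | tri> _ _ y<x = contradiction (*-monoˡ-< 0<z y<x) (≤⇒≯ xz≤yz)

  *-inverseʳ : 0r < x → x * inv x ≡ 1r
  *-inverseʳ {x} 0<x = inv-correct x λ x≡0 → <-irrefl (sym x≡0) 0<x

  inv-pos : 0r < x → 0r < inv x
  inv-pos {x} 0<x with compare (inv x) 0r
  ... | tri< x⁻¹<0 _ _ = contradiction 0<1 (≤⇒≯ (begin
    1r         ≡⟨ *-inverseʳ 0<x ⟨
    x * inv x  ≤⟨ *-monoʳ-≤ 0<x (inj₁ x⁻¹<0) ⟩
    x * 0r     ≡⟨ zeroʳ x ⟩
    0r         ∎))
  ... | tri≈ _ x⁻¹≡0 _ = contradiction 0<1 (<-irrefl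
    (trans (sym (zeroʳ x)) (trans (cong (x *_) (sym x⁻¹≡0)) (*-inverseʳ 0<x))))
  ... | tri> _ _ 0<x⁻¹ = 0<x⁻¹

  x/z*z≡x : ∀ x → 0r < z → x * inv z * z ≡ x
  x/z*z≡x {z} x 0<z = trans (*-assoc x (inv z) z)
    (trans (cong (x *_) (trans (*-comm (inv z) z) (*-inverseʳ 0<z))) (*-identityʳ x))

  xz≤y⇒x≤y/z : 0r < z → x * z ≤ y → x ≤ y * inv z
  xz≤y⇒x≤y/z {y = y} 0<z xz≤y = *-cancelʳ-≤ 0<z (≤-trans xz≤y (≤-reflexive (sym (x/z*z≡x y 0<z))))

  x≤yz⇒x/z≤y : 0r < z → x ≤ y * z → x * inv z ≤ y
  x≤yz⇒x/z≤y {x = x} 0<z x≤yz = *-cancelʳ-≤ 0<z (≤-trans (≤-reflexive (x/z*z≡x x 0<z)) x≤yz)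

  *-cancelʳ : 0r < z → x * z ≡ y * z → x ≡ y
  *-cancelʳ 0<z xz≡yz = ≤-antisym (*-cancelʳ-≤ 0<z (inj₂ xz≡yz)) (*-cancelʳ-≤ 0<z (inj₂ (sym xz≡yz)))

  x≡yz⇒x/z≡y : 0r < z → x ≡ y * z → x * inv z ≡ y
  x≡yz⇒x/z≡y {x = x} 0<z x≡yz = *-cancelʳ 0<z (trans (x/z*z≡x x 0<z) x≡yz)

-- Rearrangements of products.

module Monomials (ℝ : RealField) where
  open RealField ℝ
  open OrderedField ℝ using (*-commutativeMonoid)
  open Algebra.Solver.CommutativeMonoid *-commutativeMonoid using (solve; _⊜_; _⊕_) renaming (id to ε)

  swap-inner : ∀ a b c → a * (b * c) ≡ b * (a * c)
  swap-inner = solve 3 (λ a b c → a ⊕ b ⊕ c ⊜ b ⊕ a ⊕ c) refl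

  -- The cycle product is cut at position 1: `b`, `c`, `d` belong to the arc from there back to the
  -- start, `a` to the arc from the start. `split₂` and `split₃` cut at positions 2 and 3.
  split₁ : ∀ a b c d x y → a * b * c * d * (x * y) ≡ (b * (c * (d * x))) * (a * y)
  split₁ = solve 6 (λ a b c d x y →
    (((a ⊕ b) ⊕ c) ⊕ d) ⊕ (x ⊕ y) ⊜ (b ⊕ c ⊕ d ⊕ x) ⊕ (a ⊕ y)) refl

  split₂ : ∀ a b c d x y → a * b * c * d * (x * y) ≡ (c * (d * x)) * (a * (b * y))
  split₂ = solve 6 (λ a b c d x y →
    (((a ⊕ b) ⊕ c) ⊕ d) ⊕ (x ⊕ y) ⊜ (c ⊕ d ⊕ x) ⊕ (a ⊕ b ⊕ y)) refl

  split₃ : ∀ a b c d x y → a * b * c * d * (x * y) ≡ (d * x) * (a * (b * (c * y)))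
  split₃ = solve 6 (λ a b c d x y →
    (((a ⊕ b) ⊕ c) ⊕ d) ⊕ (x ⊕ y) ⊜ (d ⊕ x) ⊕ (a ⊕ b ⊕ c ⊕ y)) refl

  rotate : ∀ a b c d → d * (1r * (a * (b * (c * 1r)))) ≡ a * b * c * d * 1r
  rotate = solve 4 (λ a b c d → d ⊕ ε ⊕ a ⊕ b ⊕ c ⊕ ε ⊜ (((a ⊕ b) ⊕ c) ⊕ d) ⊕ ε) refl

-- The digraph of a vector and its closed walks.

module _ (ℝ : RealField) where
  open RealField ℝ
  open Real ℝ
  open OrderedField ℝ
  open Monomials ℝ
  open ≤-Reasoning

  -- For positive `w` this is `A i j ≤ ratio w i j` without division: the approximation is at or
  -- above the entry.
  Edge : Matrix → Vector → N → N → Set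
  Edge A w i j = A i j * w j ≤ w i

  edge? : ∀ A w i j → Dec (Edge A w i j)
  edge? A w i j = _ ≤? _

  -- A closed chain of inequalities passes from any position to any other and back.
  closed-≤⇒≡ : ∀ (f : N → R) {ρ : N → N} → Closed (λ i j → f i ≤ f j) ρ → ∀ p q → f (ρ p) ≡ f (ρ q)
  closed-≤⇒≡ f {ρ} (f₀≤f₁ , f₁≤f₂ , f₂≤f₃ , f₃≤f₀) p q = ≤-antisym (≤-via p q) (≤-via q p)
    where
    f₂≤₀ = ≤-trans f₂≤f₃ f₃≤f₀
    f₀≤₂ = ≤-trans f₀≤f₁ f₁≤f₂
    to₀ : ∀ p → f (ρ p) ≤ f (ρ 0F)
    to₀ 0F = ≤-refl
    to₀ 1F = ≤-trans f₁≤f₂ f₂≤₀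
    to₀ 2F = f₂≤₀
    to₀ 3F = f₃≤f₀
    from₀ : ∀ p → f (ρ 0F) ≤ f (ρ p)
    from₀ 0F = ≤-refl
    from₀ 1F = f₀≤f₁
    from₀ 2F = f₀≤₂
    from₀ 3F = ≤-trans f₀≤₂ f₂≤f₃
    ≤-via : ∀ p q → f (ρ p) ≤ f (ρ q)
    ≤-via p q = ≤-trans (to₀ p) (from₀ q)

  module _ (A : Matrix) (A-rec : Reciprocal A) where
    private
      0<a : ∀ i j → 0r < A i j
      0<a = proj₁ A-rec

    reciprocal-cancel : ∀ i j x → A i j * (A j i * x) ≡ x
    reciprocal-cancel i j x = trans (sym (*-assoc _ _ x)) (trans
      (cong (λ a → A i j * a * x) (proj₂ A-rec i j))
      (trans (cong (_* x) (*-inverseʳ (0<a i j))) (*-identityˡ x)))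

    reciprocal-flip : ∀ {i j x y} → x ≤ A j i * y → A i j * x ≤ y
    reciprocal-flip {i} {j} {x} {y} le =
      ≤-trans (*-monoʳ-≤ (0<a i j) le) (≤-reflexive (reciprocal-cancel i j y))

    reciprocal-flip′ : ∀ {i j x y} → A j i * y ≤ x → y ≤ A i j * x
    reciprocal-flip′ {i} {j} {x} {y} le =
      ≤-trans (≤-reflexive (sym (reciprocal-cancel i j y))) (*-monoʳ-≤ (0<a i j) le)

    -- If the edge from `i` to `j` fails by comparison, reciprocity turns the opposite inequality
    -- into the reverse edge.
    edge-total : ∀ w i j → Edge A w i j ⊎ Edge A w j i
    edge-total w i j = ⊎-map id reciprocal-flip (≤-total _ _)

    module _ {u v : Vector} (0<u : Positive u) (0<v : Positive v) where

      -- The arc from position `suc p` back to the start bounds `u`, the arc from the start to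
      -- `suc p` bounds `v`, and the two arcs together make up the whole cycle. In logarithms this
      -- is the length of the interval over which a coordinate difference ranges.
      width : ∀ {ρ} → Closed (Edge A u) ρ → Closed (Edge A v) ρ → ∀ p →
              cycleVal A ρ * (u (ρ 0F) * v (ρ (suc p))) ≤ u (ρ (suc p)) * v (ρ 0F)
      width {ρ} (_ , u₁₂ , u₂₃ , u₃₀) (v₀₁ , v₁₂ , v₂₃ , _) = λ where
          0F → ≤-trans (≤-reflexive (split₁ _ _ _ _ _ _))
                 (*-mono-≤ (0<u _) (*-pos _ _ (0<a _ _) (0<v _)) u₁₀ v₀₁)
          1F → ≤-trans (≤-reflexive (split₂ _ _ _ _ _ _))
                 (*-mono-≤ (0<u _) (*-pos _ _ (0<a _ _) (*-pos _ _ (0<a _ _) (0<v _))) u₂₀ v₀₂)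
          2F → ≤-trans (≤-reflexive (split₃ _ _ _ _ _ _)) (*-mono-≤ (0<u _)
                 (*-pos _ _ (0<a _ _) (*-pos _ _ (0<a _ _) (*-pos _ _ (0<a _ _) (0<v _)))) u₃₀
                 (≤-trans (*-monoʳ-≤ (0<a _ _) (≤-trans (*-monoʳ-≤ (0<a _ _) v₂₃) v₁₂)) v₀₁))
        where
        u₂₀ = ≤-trans (*-monoʳ-≤ (0<a (ρ 2F) (ρ 3F)) u₃₀) u₂₃
        u₁₀ = ≤-trans (*-monoʳ-≤ (0<a (ρ 1F) (ρ 2F)) u₂₀) u₁₂
        v₀₂ = ≤-trans (*-monoʳ-≤ (0<a (ρ 0F) (ρ 1F)) v₁₂) v₀₁

      -- Along each step of the cycle the quotient `v i * inv (u i)` cannot decrease, so it is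
      -- constant around the cycle.
      opposite⇒proportional : ∀ {ρ} → Closed (Edge A u) ρ → Closed (flip (Edge A v)) ρ →
                              ∀ p q → u (ρ p) * v (ρ q) ≡ v (ρ p) * u (ρ q)
      opposite⇒proportional {ρ} (u₀₁ , u₁₂ , u₂₃ , u₃₀) (v₁₀ , v₂₁ , v₃₂ , v₀₃) p q = begin-equality
        u (ρ p) * v (ρ q)                                  ≡⟨ cong (u (ρ p) *_) (x/z*z≡x _ (0<u (ρ q))) ⟨
        u (ρ p) * (v (ρ q) * inv (u (ρ q)) * u (ρ q))      ≡⟨ cong (λ r → u (ρ p) * (r * u (ρ q))) (ratio-constant p q) ⟨
        u (ρ p) * (v (ρ p) * inv (u (ρ p)) * u (ρ q))      ≡⟨ swap-inner _ _ _ ⟩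
        v (ρ p) * inv (u (ρ p)) * (u (ρ p) * u (ρ q))      ≡⟨ *-assoc _ _ _ ⟨
        v (ρ p) * inv (u (ρ p)) * u (ρ p) * u (ρ q)        ≡⟨ cong (_* u (ρ q)) (x/z*z≡x _ (0<u (ρ p))) ⟩
        v (ρ p) * u (ρ q)                                  ∎
        where
        step : ∀ {i j} → Edge A u i j → Edge A v j i → v i * inv (u i) ≤ v j * inv (u j)
        step {i} {j} uᵢⱼ vⱼᵢ = x≤yz⇒x/z≤y (0<u i) (begin
          v i                                ≤⟨ reciprocal-flip′ vⱼᵢ ⟩
          A i j * v j                        ≡⟨ cong (A i j *_) (x/z*z≡x (v j) (0<u j)) ⟨
          A i j * (v j * inv (u j) * u j)    ≡⟨ swap-inner _ _ _ ⟩
          v j * inv (u j) * (A i j * u j)    ≤⟨ *-monoʳ-≤ (*-pos _ _ (0<v j) (inv-pos (0<u j))) uᵢⱼ ⟩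
          v j * inv (u j) * u i              ∎)
        ratio-constant : ∀ p q → v (ρ p) * inv (u (ρ p)) ≡ v (ρ q) * inv (u (ρ q))
        ratio-constant = closed-≤⇒≡ (λ i → v i * inv (u i)) {ρ}
          (step u₀₁ v₁₀ , step u₁₂ v₂₁ , step u₂₃ v₃₂ , step u₃₀ v₀₃)

    -- On an edge a dominating `v` cannot have a larger ratio than `w`, so `v i * inv (w i)` cannot
    -- decrease along the cycle. It is therefore constant on the cycle, which visits every index.
    closed⇒efficient : ∀ {w τ} → HCycle τ → Positive w → Closed (Edge A w) τ → Efficient A w
    closed⇒efficient {w} {τ} τ-inj 0<w closed = 0<w , λ v 0<v dom →
      let step : ∀ i j → Edge A w i j → v i * inv (w i) ≤ v j * inv (w j)
          step i j wᵢⱼ = x≤yz⇒x/z≤y (0<w i) (begin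
            v i                                ≡⟨ x/z*z≡x (v i) (0<v j) ⟨
            ratio v i j * v j                  ≤⟨ *-monoˡ-≤ (0<v j)
                                                    (∣x-y∣≤∣x-z∣⇒y≤z (xz≤y⇒x≤y/z (0<w j) wᵢⱼ) (dom i j)) ⟩
            ratio w i j * v j                  ≡⟨ *-comm _ _ ⟩
            v j * (w i * inv (w j))            ≡⟨ cong (v j *_) (*-comm _ _) ⟩
            v j * (inv (w j) * w i)            ≡⟨ *-assoc _ _ _ ⟨
            v j * inv (w j) * w i              ∎)
          c = v (τ 0F) * inv (w (τ 0F))
      in c , *-pos _ _ (0<v _) (inv-pos (0<w _)) , λ i → trans (sym (x/z*z≡x (v i) (0<w i)))
           (cong (_* w i) (let p , τp≡i = injective⇒surjective τ-inj i in
             subst (λ i → v i * inv (w i) ≡ c) τp≡i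
               (closed-≤⇒≡ (λ i → v i * inv (w i)) {τ} (closed-map τ step closed) p 0F)))

  -- Efficiency excludes cuts.

  1<2 : 1r < 1r + 1r
  1<2 = subst (_< 1r + 1r) (+-identityˡ 1r) (+-mono-< _ _ 1r 0<1)

  -- Each constraint is closed downward, so the least of the finitely many bounds serves for all.
  common-bound : ∀ {n} (P : Fin n → R → Set) → (∀ i {c d} → d ≤ c → P i c → P i d) →
                 (∀ i → ∃ λ c → 1r < c × P i c) → ∃ λ c → 1r < c × (∀ i → P i c)
  common-bound {ℕ.zero} P mono bounds = 1r + 1r , 1<2 , λ ()
  common-bound {ℕ.suc n} P mono bounds
    with c , 1<c , Pc ← bounds zero
       | d , 1<d , Pd ← common-bound (P ∘ suc) (mono ∘ suc) (bounds ∘ suc)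
    with ≤-total c d
  ... | inj₁ c≤d = c , 1<c , λ where
    zero    → Pc
    (suc i) → mono (suc i) c≤d (Pd i)
  ... | inj₂ d≤c = d , 1<d , λ where
    zero    → mono zero d≤c Pc
    (suc i) → Pd i

  rescale : Vector → (N → Bool) → R → Vector
  rescale w S c i = if S i then c * w i else w i

  -- Enlarging w on one side of a cut improves every entry across the cut and changes no other.
  efficient⇒no-gap : ∀ {A w} → Reciprocal A → Efficient A w → (S : N → Bool) →
                     (∃ λ i → T (S i)) → (∃ λ j → T (not (S j))) → ∀ {c} → 1r < c →
                     ¬ (∀ i j → T (S i) → T (not (S j)) → c * w i ≤ A i j * w j)
  efficient⇒no-gap {A} {w} A-rec (0<w , w-eff) S (i , i∈S) (j , j∉S) {c} 1<c gap = <-irrefl (sym c≡1) 1<c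
    where
    0<c = <-trans 0<1 1<c

    x<cx : ∀ {x} → 0r < x → x ≤ c * x
    x<cx {x} 0<x = ≤-trans (≤-reflexive (sym (*-identityˡ x))) (*-monoˡ-≤ 0<x (inj₁ 1<c))

    v : Vector
    v = rescale w S c

    0<v : Positive v
    0<v i with S i
    ... | true  = *-pos _ _ 0<c (0<w i)
    ... | false = 0<w i

    dom : ∀ i j → ∣ A i j - ratio v i j ∣ ≤ ∣ A i j - ratio w i j ∣
    dom i j with S i | S j | gap i j | gap j i
    ... | false | false | _ | _ = ≤-refl
    ... | true  | true  | _ | _ = ≤-reflexive (cong (λ r → ∣ A i j - r ∣)
      (x≡yz⇒x/z≡y (*-pos _ _ 0<c (0<w j)) (begin-equality
        c * w i                   ≡⟨ cong (c *_) (x/z*z≡x (w i) (0<w j)) ⟨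
        c * (ratio w i j * w j)   ≡⟨ swap-inner _ _ _ ⟩
        ratio w i j * (c * w j)   ∎)))
    ... | true  | false | cwᵢ≤ | _ = x≤y≤z⇒∣z-y∣≤∣z-x∣
      (*-monoˡ-≤ (inv-pos (0<w j)) (x<cx (0<w i)))
      (x≤yz⇒x/z≤y (0<w j) (cwᵢ≤ tt tt))
    -- By reciprocity the gap from `j` to `i` puts `A i j` at or below the new ratio, which in turn
    -- is at or below the old one.
    ... | false | true  | _ | cwⱼ≤ = x≤y≤z⇒∣x-y∣≤∣x-z∣
      (xz≤y⇒x≤y/z 0<cwⱼ (reciprocal-flip A A-rec (cwⱼ≤ tt tt)))
      (xz≤y⇒x≤y/z (0<w j) (begin
        w i * inv (c * w j) * w j          ≤⟨ *-monoʳ-≤ (*-pos _ _ (0<w i) (inv-pos 0<cwⱼ)) (x<cx (0<w j)) ⟩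
        w i * inv (c * w j) * (c * w j)    ≡⟨ x/z*z≡x (w i) 0<cwⱼ ⟩
        w i                                ∎))
      where 0<cwⱼ = *-pos _ _ 0<c (0<w j)

    v-inside : ∀ i → T (S i) → v i ≡ c * w i
    v-inside i i∈S with S i
    ... | true = refl

    v-outside : ∀ j → T (not (S j)) → v j ≡ w j
    v-outside j j∉S with S j
    ... | false = refl

    c≡1 : c ≡ 1r
    -- The proportionality factor `d` equals `c` at `i` inside the cut and `1r` at `j` outside it.
    c≡1 with d , _ , v≡dw ← w-eff v 0<v dom = trans
      (*-cancelʳ (0<w i) (trans (sym (v-inside i i∈S)) (v≡dw i)))
      (*-cancelʳ (0<w j) (trans (sym (v≡dw j)) (trans (v-outside j j∉S) (sym (*-identityˡ _)))))

  -- Finitely many strict inequalities leave room for one factor above `1r`, which gives the gap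
  -- excluded before.
  efficient⇒no-cut : ∀ {A w} → Reciprocal A → Efficient A w → (S : N → Bool) →
                     (∃ λ i → T (S i)) → (∃ λ j → T (not (S j))) →
                     ¬ (∀ i j → T (S i) → T (not (S j)) → w i < A i j * w j)
  efficient⇒no-cut {A} {w} A-rec w-efficient@(0<w , _) S ∃i∈S ∃j∉S cut =
    let _ , 1<c , gap = common-bound (λ i c → ∀ j → Gap i j c) (λ i d≤c h j → gap-mono i j d≤c (h j))
                          (λ i → common-bound (Gap i) (gap-mono i) (gap i))
    in efficient⇒no-gap A-rec w-efficient S ∃i∈S ∃j∉S 1<c gap
    where
    Gap : N → N → R → Set
    Gap i j c = T (S i) → T (not (S j)) → c * w i ≤ A i j * w j

    gap-mono : ∀ i j {c d} → d ≤ c → Gap i j c → Gap i j d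
    gap-mono i j d≤c gap i∈S j∉S = ≤-trans (*-monoˡ-≤ (0<w i) d≤c) (gap i∈S j∉S)

    gap : ∀ i j → ∃ λ c → 1r < c × Gap i j c
    gap i j with T? (S i) | T? (not (S j))
    ... | no i∉S  | _       = 1r + 1r , 1<2 , λ i∈S → contradiction i∈S i∉S
    ... | yes _   | no j∈S  = 1r + 1r , 1<2 , λ _ j∉S → contradiction j∉S j∈S
    -- The largest admissible factor, at which the gap inequality is an equality.
    ... | yes i∈S | yes j∉S = A i j * w j * inv (w i) ,
      ≰⇒> (λ c≤1 → ≤⇒≯ (begin
        A i j * w j                      ≡⟨ x/z*z≡x _ (0<w i) ⟨
        A i j * w j * inv (w i) * w i    ≤⟨ *-monoˡ-≤ (0<w i) c≤1 ⟩
        1r * w i                         ≡⟨ *-identityˡ _ ⟩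
        w i                              ∎) (cut i j i∈S j∉S)) ,
      λ _ _ → ≤-reflexive (x/z*z≡x _ (0<w i))

  -- In Camion's alternative the missing edges across a cut are strict inequalities, which
  -- efficiency forbids. Vertices are relabelled by `τ` so that each cycle found starts at `τ 0F`.
  efficient⇒hamiltonian : ∀ {A w τ} → Reciprocal A → HCycle τ → Efficient A w →
                          Hamiltonian (λ p q → Edge A w (τ p) (τ q))
  efficient⇒hamiltonian {A} {w} {τ} A-rec τ-inj w-eff = fromInj₁
    (λ (S , (p , p∈S) , (q , q∉S) , cut) → contradiction
      (λ i j i∈S j∉S → subst₂ (λ i j → w i < A i j * w j) (τ∘τ⁻¹ i) (τ∘τ⁻¹ j)
                         (≰⇒> (cut (τ⁻¹ i) (τ⁻¹ j) i∈S j∉S)))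
      (efficient⇒no-cut A-rec w-eff (lookup S ∘ τ⁻¹)
        (τ p , subst (T ∘ lookup S) (sym (τ⁻¹∘τ p)) p∈S)
        (τ q , subst (T ∘ not ∘ lookup S) (sym (τ⁻¹∘τ q)) q∉S)))
    (camion (λ p q → edge? A w (τ p) (τ q)) (λ p q → edge-total A A-rec w (τ p) (τ q)))
    where
    τ⁻¹ : N → N
    τ⁻¹ i = proj₁ (injective⇒surjective τ-inj i)
    τ∘τ⁻¹ : ∀ i → τ (τ⁻¹ i) ≡ i
    τ∘τ⁻¹ i = proj₂ (injective⇒surjective τ-inj i)
    τ⁻¹∘τ : ∀ p → τ⁻¹ (τ p) ≡ p
    τ⁻¹∘τ p = τ-inj (τ∘τ⁻¹ (τ p))

  -- Two vectors on a common cycle of `B`, equal at `τ 0F` and differing by the factor `s` at `τ l`.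

  module _ {B : Matrix} (B-rec : Reciprocal B) {τ : N → N} (τ-inj : HCycle τ)
           {u v : Vector} (0<u : Positive u) (0<v : Positive v)
           {s x y : R} (s<1 : s < 1r) (0<x : 0r < x) (0<y : 0r < y) {l : N} (l≢0 : l ≢ 0F)
           (u₀ : u (τ 0F) ≡ x) (v₀ : v (τ 0F) ≡ x) (uₗ : u (τ l) ≡ s * y) (vₗ : v (τ l) ≡ y) where

    -- Apply `width` between the start and the position of `l`, then cancel `x * y`.
    aligned⇒cycleVal≤ : ∀ {ρ} → HCycle ρ → ρ 0F ≡ 0F →
      Closed (Edge B u) (τ ∘ ρ) → Closed (Edge B v) (τ ∘ ρ) → cycleVal B (τ ∘ ρ) ≤ s
    aligned⇒cycleVal≤ {ρ} ρ-inj ρ0≡0 u-closed v-closed with injective⇒surjective ρ-inj l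
    ... | zero , ρ0≡l = contradiction (trans (sym ρ0≡l) ρ0≡0) l≢0
    ... | suc p , ρp≡l = *-cancelʳ-≤ (*-pos _ _ 0<x 0<y) (begin
      σ * (x * y)                             ≡⟨ cong (σ *_) (cong₂ _*_ u₀ vₗ) ⟨
      σ * (u (τ 0F) * v (τ l))                ≡⟨ cong (σ *_) (cong₂ (λ i j → u (τ i) * v (τ j)) ρ0≡0 ρp≡l) ⟨
      σ * (u (τ (ρ 0F)) * v (τ (ρ (suc p))))  ≤⟨ width B B-rec 0<u 0<v {τ ∘ ρ} u-closed v-closed p ⟩
      u (τ (ρ (suc p))) * v (τ (ρ 0F))        ≡⟨ cong₂ (λ i j → u (τ i) * v (τ j)) ρp≡l ρ0≡0 ⟩
      u (τ l) * v (τ 0F)                      ≡⟨ cong₂ _*_ uₗ v₀ ⟩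
      s * y * x                               ≡⟨ *-assoc _ _ _ ⟩
      s * (y * x)                             ≡⟨ cong (s *_) (*-comm _ _) ⟩
      s * (x * y)                             ∎)
      where σ = cycleVal B (τ ∘ ρ)

    -- Compared at `τ 0F` and `τ l`, proportional vectors would force `s` to be `1r`.
    ¬proportional : ∀ {ρ} → HCycle ρ →
      ¬ (∀ p q → u (τ (ρ p)) * v (τ (ρ q)) ≡ u (τ (ρ q)) * v (τ (ρ p)))
    ¬proportional {ρ} ρ-inj proportional
      with p , ρp≡0 ← injective⇒surjective ρ-inj 0F
         | q , ρq≡l ← injective⇒surjective ρ-inj l = <-irrefl
      (*-cancelʳ (*-pos _ _ 0<y 0<x) (begin-equality
        s * (y * x)                   ≡⟨ *-assoc _ _ _ ⟨
        s * y * x                     ≡⟨ cong₂ _*_ uₗ v₀ ⟨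
        u (τ l) * v (τ 0F)            ≡⟨ cong₂ (λ i j → u (τ i) * v (τ j)) ρq≡l ρp≡0 ⟨
        u (τ (ρ q)) * v (τ (ρ p))     ≡⟨ proportional q p ⟩
        u (τ (ρ p)) * v (τ (ρ q))     ≡⟨ cong₂ (λ i j → u (τ i) * v (τ j)) ρp≡0 ρq≡l ⟩
        u (τ 0F) * v (τ l)            ≡⟨ cong₂ _*_ u₀ vₗ ⟩
        x * y                         ≡⟨ *-comm _ _ ⟩
        y * x                         ≡⟨ *-identityˡ _ ⟨
        1r * (y * x)                  ∎)) s<1

    -- Equal directions reduce to the aligned case, after reversal if both run backwards. Opposite
    -- directions would make `u` and `v` proportional.
    shared-cycle⇒cycleVal≤ : ∀ c → let E w p q = Edge B w (τ p) (τ q) in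
      Closed (E u) (cycle c) ⊎ Closed (flip (E u)) (cycle c) →
      Closed (E v) (cycle c) ⊎ Closed (flip (E v)) (cycle c) →
      ∃ λ σ → HCycle σ × cycleVal B σ ≤ s
    shared-cycle⇒cycleVal≤ c (inj₁ u-closed) (inj₁ v-closed) = τ ∘ cycle c , cycle-injective c ∘ τ-inj ,
      aligned⇒cycleVal≤ (cycle-injective c) (cycle-start c) u-closed v-closed
    shared-cycle⇒cycleVal≤ c (inj₂ u-closed) (inj₂ v-closed) =
      τ ∘ cycle c ∘ backwards , backwards-injective ∘ cycle-injective c ∘ τ-inj ,
      aligned⇒cycleVal≤ (backwards-injective ∘ cycle-injective c) (cycle-start c)
        (closed-backwards {E = Edge B u} {τ ∘ cycle c} u-closed)
        (closed-backwards {E = Edge B v} {τ ∘ cycle c} v-closed)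
    shared-cycle⇒cycleVal≤ c (inj₁ u-closed) (inj₂ v-closed) = contradiction
      (λ p q → trans (opposite⇒proportional B B-rec 0<u 0<v {τ ∘ cycle c} u-closed v-closed p q) (*-comm _ _))
      (¬proportional (cycle-injective c))
    shared-cycle⇒cycleVal≤ c (inj₂ u-closed) (inj₁ v-closed) = contradiction
      (λ p q → trans (*-comm _ _) (opposite⇒proportional B B-rec 0<v 0<u {τ ∘ cycle c} v-closed u-closed q p))
      (¬proportional (cycle-injective c))

  -- The vertices of the tetrahedron of an H-cycle.

  module _ {A : Matrix} (A-rec : Reciprocal A) {τ : N → N} (τ-inj : HCycle τ) (τ<1 : cycleVal A τ < 1r) where
    private
      s = cycleVal A τ
      0<a = proj₁ A-rec

      0<s : 0r < s
      0<s = *-pos _ _ (*-pos _ _ (*-pos _ _ (0<a _ _) (0<a _ _)) (0<a _ _)) (0<a _ _)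

    -- Normalised to `1r` at the last position, it turns the inequalities along the first three
    -- steps of `τ` into equalities.
    potential : N → R
    potential 0F = A (τ 0F) (τ 1F) * (A (τ 1F) (τ 2F) * (A (τ 2F) (τ 3F) * 1r))
    potential 1F = A (τ 1F) (τ 2F) * (A (τ 2F) (τ 3F) * 1r)
    potential 2F = A (τ 2F) (τ 3F) * 1r
    potential 3F = 1r

    0<potential : ∀ p → 0r < potential p
    0<potential 0F = *-pos _ _ (0<a _ _) (*-pos _ _ (0<a _ _) (*-pos _ _ (0<a _ _) 0<1))
    0<potential 1F = *-pos _ _ (0<a _ _) (*-pos _ _ (0<a _ _) 0<1)
    0<potential 2F = *-pos _ _ (0<a _ _) 0<1
    0<potential 3F = 0<1

    -- The factor `s` beyond position `k` gives slack to the step leaving `k` and, for `k` below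
    -- `3F`, makes the closing step an equality. For `k` equal to `3F` nothing drops and the slack
    -- stays in the closing step.
    drop : N → N → R
    drop k p with p ≤ᶠ? k
    ... | yes _ = 1r
    ... | no _  = s

    drop-≤ : ∀ {k p} → p ≤ᶠ k → drop k p ≡ 1r
    drop-≤ {k} {p} p≤k with p ≤ᶠ? k
    ... | yes _  = refl
    ... | no p≰k = contradiction p≤k p≰k

    drop-> : ∀ {k p} → k <ᶠ p → drop k p ≡ s
    drop-> {k} {p} k<p with p ≤ᶠ? k
    ... | yes p≤k = contradiction p≤k (<⇒≱ k<p)
    ... | no _    = refl

    s≤drop : ∀ k p → s ≤ drop k p
    s≤drop k p with p ≤ᶠ? k
    ... | yes _ = inj₁ τ<1
    ... | no _  = ≤-refl

    0<drop : ∀ k p → 0r < drop k p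
    0<drop k p with p ≤ᶠ? k
    ... | yes _ = 0<1
    ... | no _  = 0<s

    drop-antitone : ∀ k {p q} → p ≤ᶠ q → drop k q ≤ drop k p
    drop-antitone k {p} {q} p≤q with q ≤ᶠ? k
    ... | yes q≤k = ≤-reflexive (sym (drop-≤ (≤ℕ-trans p≤q q≤k)))
    ... | no _    = s≤drop k p

    -- In the simplex of vectors with an edge along every step of τ, the vertex at which
    -- only the k-th inequality is strict, listed in the order of τ.
    vertex : N → N → R
    vertex k p = drop k p * potential p

    vertexVector : N → Vector
    vertexVector k i = vertex k (proj₁ (injective⇒surjective τ-inj i))

    vertexVector-τ : ∀ k p → vertexVector k (τ p) ≡ vertex k p
    vertexVector-τ k p = cong (vertex k) (τ-inj (proj₂ (injective⇒surjective τ-inj (τ p))))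

    vertexVector-positive : ∀ k → Positive (vertexVector k)
    vertexVector-positive k i = let p , _ = injective⇒surjective τ-inj i in
      *-pos _ _ (0<drop k p) (0<potential p)

    vertexVector-efficient : ∀ k → Efficient A (vertexVector k)
    vertexVector-efficient k = closed⇒efficient A A-rec τ-inj (vertexVector-positive k)
      (edge 0F 1F (step 0F 1F (n≤1+n _)) , edge 1F 2F (step 1F 2F (n≤1+n _)) ,
       edge 2F 3F (step 2F 3F (n≤1+n _)) , edge 3F 0F (begin
         -- Position `0F` never drops, so the closing inequality reduces to `s ≤ drop k 3F`.
         A (τ 3F) (τ 0F) * (drop k 0F * potential 0F)  ≡⟨ cong (λ d → A (τ 3F) (τ 0F) * (d * potential 0F))
                                                              (drop-≤ {k} {0F} z≤n) ⟩
         A (τ 3F) (τ 0F) * (1r * potential 0F)         ≡⟨ rotate _ _ _ _ ⟩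
         s * 1r                                        ≤⟨ *-monoˡ-≤ 0<1 (s≤drop k 3F) ⟩
         drop k 3F * 1r                                ∎))
      where
      edge : ∀ p q → A (τ p) (τ q) * vertex k q ≤ vertex k p → Edge A (vertexVector k) (τ p) (τ q)
      edge p q = subst₂ (λ x y → A (τ p) (τ q) * x ≤ y) (sym (vertexVector-τ k q)) (sym (vertexVector-τ k p))
      step : ∀ p q → p ≤ᶠ q →
             A (τ p) (τ q) * vertex k q ≤ drop k p * (A (τ p) (τ q) * potential q)
      step p q p≤q = ≤-trans (≤-reflexive (swap-inner _ _ _))
        (*-monoˡ-≤ (*-pos _ _ (0<a _ _) (0<potential q)) (drop-antitone k p≤q))

    vertexVector-≤ : ∀ {k p} → p ≤ᶠ k → vertexVector k (τ p) ≡ potential p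
    vertexVector-≤ {k} {p} p≤k = trans (vertexVector-τ k p)
      (trans (cong (_* potential p) (drop-≤ p≤k)) (*-identityˡ _))

    vertexVector-> : ∀ {k p} → k <ᶠ p → vertexVector k (τ p) ≡ s * potential p
    vertexVector-> {k} {p} k<p = trans (vertexVector-τ k p) (cong (_* potential p) (drop-> k<p))

    -- All four vertices are efficient for `B`, hence each lies on one of three cycles up to
    -- reversal, and two of them share one.
    cycleVal-dominated : ∀ {B} → Reciprocal B → (∀ {w} → Efficient A w → Efficient B w) →
                         ∃ λ σ → HCycle σ × cycleVal B σ ≤ cycleVal A τ
    cycleVal-dominated {B} B-rec A⊆B = conclude
      (pigeonhole-share ≤ℕ-refl λ k → efficient⇒hamiltonian B-rec τ-inj (A⊆B (vertexVector-efficient k)))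
      where
      OnCycle : N → Fin 3 → Set
      OnCycle k c = let E p q = Edge B (vertexVector k) (τ p) (τ q) in
        Closed E (cycle c) ⊎ Closed (flip E) (cycle c)
      conclude : (∃ λ k → ∃ λ l → k <ᶠ l × ∃ λ c → OnCycle k c × OnCycle l c) →
                 ∃ λ σ → HCycle σ × cycleVal B σ ≤ cycleVal A τ
      -- Position `l` lies beyond the drop of vertex `k` but not beyond that of vertex `l`, while
      -- both agree with `potential` at `0F`.
      conclude (k , l , k<l , c , k-on-c , l-on-c) = shared-cycle⇒cycleVal≤ B-rec τ-inj
        (vertexVector-positive k) (vertexVector-positive l) τ<1 (0<potential 0F) (0<potential l)
        (λ { refl → contradiction k<l λ () })
        (vertexVector-≤ {k} {0F} z≤n) (vertexVector-≤ {l} {0F} z≤n)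
        (vertexVector-> k<l) (vertexVector-≤ {l} {l} ≤ℕ-refl) c k-on-c l-on-c

  -- Comparison of the two minima.

  Dominates : Matrix → Matrix → Set
  Dominates A B = ∀ {τ} → HCycle τ → cycleVal A τ < 1r → ∃ λ σ → HCycle σ × cycleVal B σ ≤ cycleVal A τ

  -- A minimising cycle of `A` yields a cycle of `B` with value at most `m`, while every cycle in
  -- `InΓ B` lies above one in `InΓ A` and so has value at least `m`.
  dominates⇒minΓ : ∀ {A B} → Dominates A B → Dominates B A → ∀ {m} → IsMinΓ A m → IsMinΓ B m
  dominates⇒minΓ {A} {B} A≽B B≽A {m} ((τ , (τ-inj , τ<1) , refl) , m-min)
    with σ , σ-inj , σ≤m ← A≽B τ-inj τ<1 =
    (σ , (σ-inj , ≤-<-trans σ≤m τ<1) , ≤-antisym σ≤m (lower-bound σ (σ-inj , ≤-<-trans σ≤m τ<1))) , lower-bound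
    where
    ≤-<-trans : ∀ {x y z} → x ≤ y → y < z → x < z
    ≤-<-trans {x} {y} {z} x≤y y<z = begin-strict x ≤⟨ x≤y ⟩ y <⟨ y<z ⟩ z ∎
    lower-bound : ∀ ρ → InΓ B ρ → m ≤ cycleVal B ρ
    lower-bound ρ (ρ-inj , ρ<1) with ρ′ , ρ′-inj , ρ′≤ρ ← B≽A ρ-inj ρ<1 =
      ≤-trans (m-min ρ′ (ρ′-inj , ≤-<-trans ρ′≤ρ ρ<1)) ρ′≤ρ

  sameEfficient⇒minΓ : ∀ {A B} → Reciprocal A → Reciprocal B → SameEfficient A B →
                       ∀ {m} → IsMinΓ A m → IsMinΓ B m
  sameEfficient⇒minΓ {A} {B} A-rec B-rec same = dominates⇒minΓ {A} {B}
    (λ {τ} τ-inj τ<1 → cycleVal-dominated A-rec {τ} τ-inj τ<1 B-rec (λ {w} → proj₁ (same w)))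
    (λ {τ} τ-inj τ<1 → cycleVal-dominated B-rec {τ} τ-inj τ<1 A-rec (λ {w} → proj₂ (same w)))

theorem10p1 : (ℝ : RealField) → let open Real ℝ in
    ∀ (A B : Matrix) → PC⁰ A → PC⁰ B → SameEfficient A B →
    ∀ (m : RealField.R ℝ) → (IsMinΓ A m → IsMinΓ B m) × (IsMinΓ B m → IsMinΓ A m)
theorem10p1 ℝ A B (A-rec , _) (B-rec , _) same m =
  sameEfficient⇒minΓ ℝ {A} {B} A-rec B-rec same ,
  sameEfficient⇒minΓ ℝ {B} {A} B-rec A-rec (λ w → proj₂ (same w) , proj₁ (same w))
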